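{- Let $X$ be a homogeneously self-similar graph with constant inner degree $b$. Then the following conditions are equivalent: (i) $X$ has bounded geometry. (ii) $b=\theta_X-1$. (iii) $X$ is locally finite and $\deg_X v=\deg_{X_F}v$ for all $v\in F$. (iv) $\delta_X=|\delta C_n|$ for any $n$-cell $C_n$ (for every positive integer $n$). (v) For any vertex $v$ in the boundary of any $n$-cell $C_n$ ($n$ any positive integer) there is exactly one cell $C$ contained in $C_n$ such that $v\in\theta C$. (vi) $\delta_X=\theta_X(\theta_X-1)$.
   Context: Graph $X$ with vertex set $VX$ and edge set $EX$ is connected, locally finite, infinite, without loops or multiple edges. $d_X$ is the graph distance and $\deg_X x$ the number of neighbours of $x$ in $X$. For $C\subset VX$, the boundary $\theta C$ is the set of vertices in $VX\setminus C$ adjacent to some vertex of $C$; the closure is $\overline{C}=C\cup\theta C$; $\hat C$ is the subgraph of $X$ spanned (induced) by $\overline{C}$; the edge boundary $\delta C$ is the set of edges connecting a vertex in $C$ with a vertex in $VX\setminus C$. For $F\subset VX$, $\mathcal{C}_XF$ denotes the set of connected components of $VX\setminus F$ (as vertex sets). The reduced graph $X_F$ has vertex set $F$, and two (distinct) vertices $x,y\in F$ are adjacent in $X_F$ iff there is $C\in\mathcal{C}_XF$ with $x,y\in\theta C$. $X$ is self-similar with respect to $F\subset VX$ and $\psi:VX\to F$ if: (F1) no two vertices of $F$ are adjacent in $X$; (F2) the intersection of the closures of two different components in $\mathcal{C}_XF$ contains at most one vertex; (F3) $\psi$ is a graph isomorphism from $X$ to $X_F$. Put $F^0=VX$, $F^n=\psi^n(VX)$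 (so $F^1=F$). Elements of $\mathcal{C}_XF^n$ are called $n$-cells; $1$-cells are called cells. A self-similar graph $X$ is homogeneously self-similar if: (H1) all cell graphs $\hat C$ ($C\in\mathcal{C}_XF$) are finite and for any cells $C,D$ there is a graph isomorphism $\alpha:\hat C\to\hat D$ with $\alpha(\theta C)=\theta D$; (H2) for every cell $C$ and $v_1,v_2,v_3,v_4\in\theta C$ with $v_1\neq v_2$, $v_3\ne v_4$, one has $d_X(v_1,v_2)=d_X(v_3,v_4)$. Put $\theta_X=|\theta C|$ and $\delta_X=|\delta C|$ for a cell $C$ (independent of the choice of $C$). $X$ has bounded geometry if the set of its vertex degrees is bounded. A number $b$ is a constant inner degree of $X$ if $b=\deg_{\hat C}v$ for every cell $C$ and every $v\in\theta C$. -}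

module Defs where

open import Level using (Level; 0ℓ; _⊔_) renaming (suc to lsuc)
open import Data.List.Base using (List; length)
open import Data.List.Membership.Propositional using () renaming (_∈_ to _∈ᴸ_)
open import Data.List.Relation.Unary.Unique.Propositional using (Unique)
open import Data.Nat.Base using (ℕ; zero; suc; _≤_)
open import Data.Product using (Σ; ∃-syntax; ∃!; _×_; _,_; proj₁)
open import Function.Base using (_∘_)
open import Function.Bundles using (_⇔_)
open import Relation.Binary.Construct.Closure.ReflexiveTransitive using (Star)
open import Relation.Binary.Core using (Rel)
open import Relation.Binary.Definitions using (Symmetric)
open import Relation.Binary.PropositionalEquality using (_≡_; _≢_; refl; sym)
open import Relation.Nullary using (¬_)
open import Relation.Unary using (Pred; _∈_; _∉_; _⊆_; _≐_; _∪_; _∩_; ∁; U)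

private
  variable
    a b ℓ ℓ′ : Level
    A : Set a
    B : Set b
    V : Set
    S T : Pred V 0ℓ

Image : (A → B) → Pred A ℓ → Pred B _
Image f P y = ∃[ x ] (x ∈ P × f x ≡ y)

-- P has exactly n elements: it is enumerated without repetition by a
-- list of length n.
HasSize : {A : Set a} → Pred A ℓ → ℕ → Set _
HasSize {A = A} P n =
  Σ (List A) λ xs → Unique xs × length xs ≡ n × (∀ x → x ∈ᴸ xs ⇔ x ∈ P)

Finite : {A : Set a} → Pred A ℓ → Set _
Finite P = ∃[ n ] HasSize P n

-- Simple graphs whose vertex set is a subset S of a type V.  Keeping the
-- ambient type lets X, its induced subgraphs and its reduced graph share
-- their vertices, and does not count different proofs of x ∈ S as
-- different vertices.
record Graph {V : Set} (S : Pred V 0ℓ) (ℓ : Level) : Set (lsuc ℓ) where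
  infix 4 _~_
  field
    _~_       : Rel V ℓ
    ~-sym     : Symmetric _~_
    ~-irrefl  : ∀ {x} → ¬ (x ~ x)
    ~-vertex  : ∀ {x y} → x ~ y → x ∈ S

open Graph public using (_~_)

Neighbours : Graph {V} S ℓ → V → Pred V ℓ
Neighbours G x y = _~_ G x y

HasDegree : Graph {V} S ℓ → V → ℕ → Set ℓ
HasDegree G x n = HasSize (Neighbours G x) n

Connected : Graph {V} S ℓ → Set ℓ
Connected {S = S} G = ∀ {x y} → x ∈ S → y ∈ S → Star (_~_ G) x y

LocallyFinite : Graph {V} S ℓ → Set ℓ
LocallyFinite {S = S} G = ∀ {x} → x ∈ S → Finite (Neighbours G x)

BoundedGeometry : Graph {V} S ℓ → Set ℓ
BoundedGeometry {S = S} G =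
  ∃[ M ] (∀ {x} → x ∈ S → ∃[ n ] (HasDegree G x n × n ≤ M))

data Walk (G : Graph {V} S ℓ) : ℕ → V → V → Set ℓ where
  []  : ∀ {x} → Walk G zero x x
  _∷_ : ∀ {n x y z} → _~_ G x y → Walk G n y z → Walk G (suc n) x z

-- HasDistance G x y n : a shortest walk from x to y has length n.
HasDistance : Graph {V} S ℓ → V → V → ℕ → Set ℓ
HasDistance G x y n = Walk G n x y × (∀ m → Walk G m x y → n ≤ m)

-- Only the restriction of f to the vertex set of the source matters.
record IsIsomorphism (G : Graph {V} S ℓ) (H : Graph {V} T ℓ′)
                     (f : V → V) : Set (ℓ ⊔ ℓ′) where
  field
    into       : ∀ {x} → x ∈ S → f x ∈ T
    injective  : ∀ {x y} → x ∈ S → y ∈ S → f x ≡ f y → x ≡ y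
    surjective : ∀ {y} → y ∈ T → ∃[ x ] (x ∈ S × f x ≡ y)
    adjacent   : ∀ {x y} → x ∈ S → y ∈ S → _~_ G x y ⇔ _~_ H (f x) (f y)

FullGraph : Set → Set₁
FullGraph V = Graph {V} U 0ℓ

record IsAmbient (X : FullGraph V) : Set where
  field
    connected     : Connected X
    locallyFinite : LocallyFinite X
    infinite      : ¬ Finite (U {A = V})

induced : FullGraph V → (S : Pred V 0ℓ) → Graph S 0ℓ
induced X S = record
  { _~_      = λ x y → x ∈ S × y ∈ S × _~_ X x y
  ; ~-sym    = λ (x∈S , y∈S , x~y) → y∈S , x∈S , Graph.~-sym X x~y
  ; ~-irrefl = λ (_ , _ , x~x) → Graph.~-irrefl X x~x
  ; ~-vertex = proj₁
  }

θ : FullGraph V → Pred V 0ℓ → Pred V 0ℓ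
θ X C y = y ∉ C × ∃[ x ] (x ∈ C × _~_ X x y)

closure : FullGraph V → Pred V 0ℓ → Pred V 0ℓ
closure X C = C ∪ θ X C

hat : (X : FullGraph V) (C : Pred V 0ℓ) → Graph (closure X C) 0ℓ
hat X C = induced X (closure X C)

-- An edge between C and its complement is represented by its unique
-- orientation pointing out of C, so no edge is counted twice.
δ : {V : Set} → FullGraph V → Pred V 0ℓ → Pred (V × V) 0ℓ
δ X C (x , y) = x ∈ C × y ∉ C × _~_ X x y

-- 𝒞 X F C : the set C is a connected component of V ∖ F, that is, up to
-- ≐, the class of some vertex under reachability avoiding F.
𝒞 : {V : Set} → FullGraph V → Pred V 0ℓ → Pred (Pred V 0ℓ) 0ℓ
𝒞 X F C = ∃[ x ] (x ∉ F × C ≐ Star (_~_ (induced X (∁ F))) x)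

reduced : (X : FullGraph V) (F : Pred V 0ℓ) → Graph F (lsuc 0ℓ)
reduced X F = record
  { _~_      = λ x y → x ∈ F × y ∈ F × x ≢ y ×
                       ∃[ C ] (C ∈ 𝒞 X F × x ∈ θ X C × y ∈ θ X C)
  ; ~-sym    = λ (x∈F , y∈F , x≢y , C , C∈𝒞 , x∈θ , y∈θ) →
                 y∈F , x∈F , x≢y ∘ sym , C , C∈𝒞 , y∈θ , x∈θ
  ; ~-irrefl = λ (_ , _ , x≢x , _) → x≢x refl
  ; ~-vertex = proj₁
  }

record IsSelfSimilar (X : FullGraph V) (F : Pred V 0ℓ) (ψ : V → V) :
                     Set₁ where
  field
    F1 : ∀ {x y} → x ∈ F → y ∈ F → ¬ (_~_ X x y)
    F2 : ∀ {C D} → C ∈ 𝒞 X F → D ∈ 𝒞 X F → ¬ (C ≐ D) →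
         ∀ {x y} → x ∈ closure X C ∩ closure X D →
                   y ∈ closure X C ∩ closure X D → x ≡ y
    F3 : IsIsomorphism X (reduced X F) ψ

-- power ψ n = ψⁿ(V)
power : {V : Set} → (V → V) → ℕ → Pred V 0ℓ
power ψ zero    = U
power ψ (suc n) = Image ψ (power ψ n)

record IsHomogeneouslySelfSimilar (X : FullGraph V) (F : Pred V 0ℓ)
                                  (ψ : V → V) : Set₁ where
  field
    isSelfSimilar : IsSelfSimilar X F ψ
    H1-finite     : ∀ {C} → C ∈ 𝒞 X F → Finite (closure X C)
    H1-iso        : ∀ {C D} → C ∈ 𝒞 X F → D ∈ 𝒞 X F →
                    ∃[ α ] (IsIsomorphism (hat X C) (hat X D) α ×
                            Image α (θ X C) ≐ θ X D)
    H2            : ∀ {C} → C ∈ 𝒞 X F → ∀ {v₁ v₂ v₃ v₄} →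
                    v₁ ∈ θ X C → v₂ ∈ θ X C → v₃ ∈ θ X C → v₄ ∈ θ X C →
                    v₁ ≢ v₂ → v₃ ≢ v₄ →
                    ∃[ n ] (HasDistance X v₁ v₂ n × HasDistance X v₃ v₄ n)

IsConstantInnerDegree : FullGraph V → Pred V 0ℓ → ℕ → Set₁
IsConstantInnerDegree X F b =
  ∀ {C} → C ∈ 𝒞 X F → ∀ {v} → v ∈ θ X C → HasDegree (hat X C) v b

DegreesPreserved : FullGraph V → Pred V 0ℓ → Set₁
DegreesPreserved X F =
  ∀ {v} → v ∈ F → ∃[ n ] (HasDegree X v n × HasDegree (reduced X F) v n)

ConstantEdgeBoundary : FullGraph V → (V → V) → ℕ → Set₁
ConstantEdgeBoundary X ψ δX =
  ∀ n → 1 ≤ n → ∀ {Cₙ} → Cₙ ∈ 𝒞 X (power ψ n) → HasSize (δ X Cₙ) δX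

UniqueBoundaryCell : FullGraph V → Pred V 0ℓ → (V → V) → Set₁
UniqueBoundaryCell X F ψ =
  ∀ n → 1 ≤ n → ∀ {Cₙ} → Cₙ ∈ 𝒞 X (power ψ n) → ∀ {v} → v ∈ θ X Cₙ →
  ∃! _≐_ λ C → C ∈ 𝒞 X F × C ⊆ Cₙ × v ∈ θ X C

{-# OPTIONS --safe #-}
-- Fix v = ψ(w) in F and double count the pairs (y , u), where y is an
-- X-neighbour of v, u is an X_F-neighbour of v, and y and u belong to a
-- common cell at v.  Each y has θ_X - 1 partners and each u has b, so
-- deg(ψ w) (θ_X - 1) = deg(w) b.  Hence degrees along w, ψ w, ψ² w, ... grow
-- strictly, decrease strictly or stay constant according to the sign of
-- b - (θ_X - 1); decrease is absurd and growth contradicts (i).  The same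
-- count restricted to neighbours inside an (n+1)-cell D relates D to the
-- n-cell ψ⁻¹(D), whose boundary is ψ⁻¹(θD); so b = θ_X - 1 makes the inner
-- degree of every n-cell equal to b, while (iv) or (v) for a single 2-cell
-- already forces b² = b (θ_X - 1).
module Submission where

open import Defs hiding (_~_)
open import Axiom.ExcludedMiddle using (ExcludedMiddle)
open import Data.Empty using (⊥-elim)
open import Data.List.Base using (List; []; _∷_; _++_; length; map; filter)
open import Data.List.Membership.Propositional using () renaming (_∈_ to _∈ᴸ_)
open import Data.List.Membership.Propositional.Properties using (∈-map⁺; ∈-map⁻; ∈-++⁺ˡ; ∈-++⁺ʳ; ∈-++⁻; ∈-filter⁺; ∈-filter⁻; ∈-∃++)
open import Data.List.Properties using (length-map; length-++)
open import Data.List.Relation.Binary.Permutation.Propositional using (↭-sym; ↭⇒↭ₛ)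
open import Data.List.Relation.Binary.Permutation.Propositional.Properties using (shift; ↭-length; ∈-resp-↭)
import Data.List.Relation.Binary.Permutation.Setoid.Properties as SetoidPermutation
import Data.List.Relation.Unary.All as All
open import Data.List.Relation.Unary.AllPairs using ([]; _∷_)
open import Data.List.Relation.Unary.Any using (here; there)
open import Data.List.Relation.Unary.Unique.Propositional using (Unique)
open import Data.List.Relation.Unary.Unique.Propositional.Properties using (++⁺; filter⁺; Unique[x∷xs]⇒x∉xs)
open import Data.Nat.Base using (ℕ; zero; suc; NonZero; >-nonZero; _+_; _*_; _∸_; _≤_; _<_; pred; z≤n; s≤s; z<s; s≤s⁻¹; >-nonZero⁻¹)
open import Data.Nat.Properties
open import Data.Product.Base using (∃; ∃-syntax; _×_; _,_; proj₁; proj₂; swap)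
open import Data.Sum.Base using (inj₁; inj₂; _⊎_; [_,_]′)
open import Function.Base using (_∘_; id; case_of_)
open import Function.Bundles using (_⇔_; mk⇔; module Equivalence)
open import Level using (Level; 0ℓ)
open import Relation.Binary.Construct.Closure.ReflexiveTransitive as Star using (Star; ε; _◅_; _◅◅_)
open import Relation.Binary.Core using (REL)
open import Relation.Binary.Definitions using (tri<; tri≈; tri>)
open import Relation.Binary.PropositionalEquality using (_≡_; _≢_; refl; sym; trans; cong; subst; setoid)
open import Relation.Nullary using (¬_; Dec; yes; no; contradiction)
open import Relation.Nullary.Decidable using (decidable-stable)
open import Relation.Unary using (Pred; _∈_; _∉_; _⊆_; _≐_; _∪_; _∩_; _∖_; ｛_｝; ∁; U; ∅)

open Equivalence using (to; from)

private
  variable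
    a b p q r : Level
    A : Set a
    B : Set b
    P : Pred A p
    Q : Pred A q
    m n k l : ℕ

-- Cardinalities of finite sets and double counting.

HasSize-resp-≐ : P ≐ Q → HasSize P n → HasSize Q n
HasSize-resp-≐ (P⊆Q , Q⊆P) (xs , xs! , len , mem) =
  xs , xs! , len , λ x → mk⇔ (P⊆Q ∘ to (mem x)) (from (mem x) ∘ Q⊆P)

HasSize-image : (f : A → B) → (∀ {x y} → x ∈ P → y ∈ P → f x ≡ f y → x ≡ y) →
                HasSize P n → HasSize (Image f P) n
HasSize-image {P = P} f inj (xs , xs! , len , mem) =
  map f xs , map! xs! (λ {x} → to (mem x)) , trans (length-map f xs) len ,
  λ y → mk⇔ (λ y∈ → let x , x∈xs , y≡fx = ∈-map⁻ f y∈ in x , to (mem x) x∈xs , sym y≡fx)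
            (λ { (x , x∈P , refl) → ∈-map⁺ f (from (mem x) x∈P) })
  where
  map! : ∀ {xs} → Unique xs → (∀ {x} → x ∈ᴸ xs → x ∈ P) → Unique (map f xs)
  map! []          xs⊆P = []
  map! xs!@(_ ∷ xs!′) xs⊆P =
    All.tabulate (λ fy∈ fx≡fy → let y , y∈xs , eq = ∈-map⁻ f fy∈ in
      Unique[x∷xs]⇒x∉xs xs!
        (subst (_∈ᴸ _) (sym (inj (xs⊆P (here refl)) (xs⊆P (there y∈xs)) (trans fx≡fy eq))) y∈xs))
    ∷ map! xs!′ (xs⊆P ∘ there)

HasSize-∪ : (∀ {x} → x ∈ P → x ∉ Q) → HasSize P m → HasSize Q n → HasSize (P ∪ Q) (m + n)
HasSize-∪ disjoint (xs , xs! , refl , memˣ) (ys , ys! , refl , memʸ) =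
  xs ++ ys , ++⁺ xs! ys! (λ (x∈xs , x∈ys) → disjoint (to (memˣ _) x∈xs) (to (memʸ _) x∈ys)) ,
  length-++ xs ,
  λ z → mk⇔ ([ inj₁ ∘ to (memˣ z) , inj₂ ∘ to (memʸ z) ]′ ∘ ∈-++⁻ xs)
            [ ∈-++⁺ˡ ∘ from (memˣ z) , ∈-++⁺ʳ xs ∘ from (memʸ z) ]′

-- A permutation brings x to the head of the enumerating list, and the tail enumerates the rest.
-- Comparisons of sizes use this as their induction step.
HasSize-∖ : ∀ {x} → x ∈ P → HasSize P n → ∃[ m ] (n ≡ suc m × HasSize (P ∖ ｛ x ｝) m)
HasSize-∖ {x = x} x∈P (xs , xs! , refl , mem)
  with ys , zs , refl ← ∈-∃++ (from (mem x) x∈P)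
  with perm ← shift x ys zs
  with x∷!@(_ ∷ rest!) ← SetoidPermutation.Unique-resp-↭ (setoid _) (↭⇒↭ₛ perm) xs!
  = length (ys ++ zs) , ↭-length perm , ys ++ zs , rest! , refl ,
    λ z → mk⇔ (λ z∈ → to (mem z) (∈-resp-↭ (↭-sym perm) (there z∈))
                      , λ { refl → Unique[x∷xs]⇒x∉xs x∷! z∈ })
              (λ (z∈P , x≢z) → drop-head (x≢z ∘ sym) (∈-resp-↭ perm (from (mem z) z∈P)))
  where
  drop-head : ∀ {A : Set a} {z x : A} {xs} → z ≢ x → z ∈ᴸ x ∷ xs → z ∈ᴸ xs
  drop-head z≢x (here z≡x)  = contradiction z≡x z≢x
  drop-head z≢x (there z∈) = z∈

HasSize-mono : P ⊆ Q → HasSize P m → HasSize Q n → m ≤ n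
HasSize-mono {P = P} P⊆Q (xs , xs! , refl , mem) = go xs xs! (λ {x} → P⊆Q ∘ to (mem x))
  where
  go : ∀ {q} {Q : Pred _ q} {n} xs → Unique xs → (∀ {x} → x ∈ᴸ xs → x ∈ Q) → HasSize Q n → length xs ≤ n
  go []       _             _    _     = z≤n
  go (x ∷ xs) xs!@(_ ∷ xs!′) xs⊆Q sizeQ
    with m , refl , size ← HasSize-∖ (xs⊆Q (here refl)) sizeQ
    = s≤s (go xs xs!′ (λ y∈ → xs⊆Q (there y∈) , λ { refl → Unique[x∷xs]⇒x∉xs xs! y∈ }) size)

HasSize-unique : HasSize P m → HasSize P n → m ≡ n
HasSize-unique sizeₘ sizeₙ =
  ≤-antisym (HasSize-mono (λ x∈ → x∈) sizeₘ sizeₙ) (HasSize-mono (λ x∈ → x∈) sizeₙ sizeₘ)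

-- Removing x from Q would leave fewer than n elements and still all of P. The double negation
-- avoids assuming that membership in P is decidable.
⊆∧sameSize⇒⊇ : P ⊆ Q → HasSize P n → HasSize Q n → ∀ {x} → x ∈ Q → ¬ x ∉ P
⊆∧sameSize⇒⊇ P⊆Q sizeP sizeQ x∈Q x∉P
  with m , refl , size ← HasSize-∖ x∈Q sizeQ
  = 1+n≰n (HasSize-mono (λ y∈P → P⊆Q y∈P , λ { refl → x∉P y∈P }) sizeP size)

HasSize-inhabited : 0 < n → HasSize P n → ∃ P
HasSize-inhabited 0<n (x ∷ _ , _ , _ , mem) = x , to (mem x) (here refl)
HasSize-inhabited ()  ([] , _ , refl , _)

HasSize-positive : ∀ {x} → x ∈ P → HasSize P n → 0 < n
HasSize-positive x∈P size with _ , refl , _ ← HasSize-∖ x∈P size = z<s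

Finite-∩ : ExcludedMiddle q → {P : Pred A p} (Q : Pred A q) → Finite P → Finite (P ∩ Q)
Finite-∩ em Q (_ , xs , xs! , _ , mem) =
  _ , filter Q? xs , filter⁺ Q? xs! , refl ,
  λ x → mk⇔ (λ x∈ → let x∈xs , x∈Q = ∈-filter⁻ Q? x∈ in to (mem x) x∈xs , x∈Q)
            (λ (x∈P , x∈Q) → ∈-filter⁺ Q? (from (mem x) x∈P) x∈Q)
  where
  Q? : ∀ x → Dec (Q x)
  Q? x = em

HasSize-pairs : {A : Set a} {B : Set b} {P : Pred A p} {R : REL A B r} → HasSize P m → (∀ {x} → x ∈ P → HasSize (R x) k) →
                HasSize (λ (x , y) → x ∈ P × R x y) (m * k)
HasSize-pairs {k = k} {A = A} {B = B} {R = R} (xs , xs! , refl , mem) sizeR =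
  HasSize-resp-≐ ( (λ (x∈ , Rxy) → to (mem _) x∈ , Rxy)
                 , (λ (x∈ , Rxy) → from (mem _) x∈ , Rxy))
                 (go xs xs! (sizeR ∘ to (mem _)))
  where
  go : ∀ xs → Unique xs → (∀ {x} → x ∈ᴸ xs → HasSize (R x) k) →
       HasSize {A = A × B} (λ (x , y) → x ∈ᴸ xs × R x y) (length xs * k)
  go []       _              _    = [] , [] , refl , λ _ → mk⇔ (λ ()) (λ ())
  go (x ∷ xs) xs!@(_ ∷ xs!′) size =
    HasSize-resp-≐
      ( (λ { (inj₁ (_ , Rxy , refl)) → here refl , Rxy ; (inj₂ (x∈ , Rxy)) → there x∈ , Rxy })
      , (λ { (here refl , Rxy) → inj₁ (_ , Rxy , refl) ; (there x∈ , Rxy) → inj₂ (x∈ , Rxy) }))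
      (HasSize-∪ (λ { (_ , _ , refl) (x∈ , _) → Unique[x∷xs]⇒x∉xs xs! x∈ })
        (HasSize-image (x ,_) (λ { _ _ refl → refl }) (size (here refl)))
        (go xs xs!′ (size ∘ there)))

HasSize-swap : {A : Set a} {B : Set b} {R : Pred (A × B) r} → HasSize R n → HasSize (R ∘ swap) n
HasSize-swap size =
  HasSize-resp-≐ ((λ { (_ , Rxy , refl) → Rxy }) , (λ Rxy → _ , Rxy , refl))
                 (HasSize-image swap (λ { _ _ refl → refl }) size)

double-counting : {A : Set a} {B : Set b} {P : Pred A p} {Q : Pred B q} (R : REL A B r) →
                  HasSize P m → HasSize Q n →
                  (∀ {x} → x ∈ P → HasSize (λ y → y ∈ Q × R x y) k) →
                  (∀ {y} → y ∈ Q → HasSize (λ x → x ∈ P × R x y) l) →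
                  m * k ≡ n * l
double-counting R sizeP sizeQ right left =
  HasSize-unique (HasSize-pairs sizeP right)
    (HasSize-resp-≐ ( (λ (y∈ , x∈ , Rxy) → x∈ , y∈ , Rxy)
                    , (λ (x∈ , y∈ , Rxy) → y∈ , x∈ , Rxy))
                    (HasSize-swap (HasSize-pairs sizeQ left)))

-- Components of a complement and their boundaries.

module Components (em : ExcludedMiddle 0ℓ) {V : Set} (X : FullGraph V) where
  open Graph X using (_~_; ~-sym)

  stable : {P : Set} → ¬ ¬ P → P
  stable = decidable-stable em

  component : Pred V 0ℓ → V → Pred V 0ℓ
  component K = Star (Graph._~_ (induced X (∁ K)))

  θ-mono : ∀ {C D} → C ≐ D → θ X C ⊆ θ X D
  θ-mono (C⊆D , D⊆C) (v∉C , y , y∈C , y~v) = v∉C ∘ D⊆C , y , C⊆D y∈C , y~v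

  component-antitone : ∀ {K L} → K ⊆ L → ∀ {x} → component L x ⊆ component K x
  component-antitone K⊆L = Star.map λ (x∉L , y∉L , x~y) → x∉L ∘ K⊆L , y∉L ∘ K⊆L , x~y

  𝒞-resp-≐ : ∀ {K L C} → K ≐ L → C ∈ 𝒞 X K → C ∈ 𝒞 X L
  𝒞-resp-≐ (K⊆L , L⊆K) (x , x∉K , C⊆ , ⊆C) =
    x , x∉K ∘ L⊆K , component-antitone L⊆K ∘ C⊆ , ⊆C ∘ component-antitone K⊆L

  module _ {K : Pred V 0ℓ} where

    component-sym : ∀ {x y} → component K x y → component K y x
    component-sym = Star.reverse λ (x∉K , y∉K , x~y) → y∉K , x∉K , ~-sym x~y

    component-avoids : ∀ {x y} → x ∉ K → component K x y → y ∉ K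
    component-avoids x∉K ε                      = x∉K
    component-avoids x∉K ((_ , y∉K , _) ◅ path) = component-avoids y∉K path

    component∈𝒞 : ∀ {x} → x ∉ K → component K x ∈ 𝒞 X K
    component∈𝒞 {x} x∉K = x , x∉K , id , id

    ∈𝒞⇒avoids : ∀ {C x} → C ∈ 𝒞 X K → x ∈ C → x ∉ K
    ∈𝒞⇒avoids (_ , o∉K , C⊆ , _) x∈C = component-avoids o∉K (C⊆ x∈C)

    ∈𝒞⇒component⊆ : ∀ {C x} → C ∈ 𝒞 X K → x ∈ C → component K x ⊆ C
    ∈𝒞⇒component⊆ (_ , _ , C⊆ , ⊆C) x∈C path = ⊆C (C⊆ x∈C ◅◅ path)

    ∈𝒞⇒⊆component : ∀ {C x} → C ∈ 𝒞 X K → x ∈ C → C ⊆ component K x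
    ∈𝒞⇒⊆component (_ , _ , C⊆ , _) x∈C y∈C = component-sym (C⊆ x∈C) ◅◅ C⊆ y∈C

    ∈𝒞⇒extend : ∀ {C x y} → C ∈ 𝒞 X K → x ∈ C → y ∉ K → x ~ y → y ∈ C
    ∈𝒞⇒extend C∈𝒞 x∈C y∉K x~y =
      ∈𝒞⇒component⊆ C∈𝒞 x∈C ((∈𝒞⇒avoids C∈𝒞 x∈C , y∉K , x~y) ◅ ε)

    ∈𝒞⇒θ⊆ : ∀ {C} → C ∈ 𝒞 X K → θ X C ⊆ K
    ∈𝒞⇒θ⊆ C∈𝒞 (v∉C , y , y∈C , y~v) = stable λ v∉K → v∉C (∈𝒞⇒extend C∈𝒞 y∈C v∉K y~v)

    𝒞-disjoint : ∀ {C D x} → C ∈ 𝒞 X K → D ∈ 𝒞 X K → x ∈ C → x ∈ D → C ≐ D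
    𝒞-disjoint C∈𝒞 D∈𝒞 x∈C x∈D =
      ∈𝒞⇒component⊆ D∈𝒞 x∈D ∘ ∈𝒞⇒⊆component C∈𝒞 x∈C ,
      ∈𝒞⇒component⊆ C∈𝒞 x∈C ∘ ∈𝒞⇒⊆component D∈𝒞 x∈D

    ∈θ : ∀ {C y v} → C ∈ 𝒞 X K → y ∈ C → v ∈ K → v ~ y → v ∈ θ X C
    ∈θ C∈𝒞 y∈C v∈K v~y = (λ v∈C → ∈𝒞⇒avoids C∈𝒞 v∈C v∈K) , _ , y∈C , ~-sym v~y

  -- Removing more vertices refines the components; in particular a cell that meets an n-cell lies
  -- inside it.
  𝒞-⊆ : ∀ {K L C D x} → K ⊆ L → C ∈ 𝒞 X L → D ∈ 𝒞 X K → x ∈ C → x ∈ D → C ⊆ D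
  𝒞-⊆ K⊆L C∈𝒞 D∈𝒞 x∈C x∈D =
    ∈𝒞⇒component⊆ D∈𝒞 x∈D ∘ component-antitone K⊆L ∘ ∈𝒞⇒⊆component C∈𝒞 x∈C

  -- Edges are grouped by their endpoint outside C, which ranges over θC; the swap restores the
  -- orientation out of C.
  δ-size : ∀ {C} → HasSize (θ X C) m → (∀ {v} → v ∈ θ X C → HasSize (λ y → v ~ y × y ∈ C) n) →
           HasSize (δ X C) (m * n)
  δ-size sizeθ degree =
    HasSize-resp-≐ ( (λ ((v∉C , _) , v~y , y∈C) → y∈C , v∉C , ~-sym v~y)
                   , (λ (y∈C , v∉C , y~v) → (v∉C , _ , y∈C , y~v) , ~-sym y~v , y∈C))
                   (HasSize-swap (HasSize-pairs sizeθ degree))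

-- Contraction of walks along ψ⁻¹.

-- From a walk between points of F in X one obtains a walk in X itself by
-- applying ψ⁻¹ to the successive visits to F; by (F1) consecutive visits
-- are at least two steps apart.
module Contraction (em : ExcludedMiddle 0ℓ) {V : Set} (X : FullGraph V) (F : Pred V 0ℓ) (ψ : V → V)
                   (selfSimilar : IsSelfSimilar X F ψ) where
  open Graph X using (_~_; ~-sym)
  open Components em X
  open IsSelfSimilar selfSimilar
  open IsIsomorphism F3 public using () renaming (surjective to ψ-surjective)

  ψ∈F : ∀ {x} → ψ x ∈ F
  ψ∈F = IsIsomorphism.into F3 _

  ψ-injective : ∀ {x y} → ψ x ≡ ψ y → x ≡ y
  ψ-injective = IsIsomorphism.injective F3 _ _

  ψ-adjacent : ∀ {x y} → x ~ y ⇔ Graph._~_ (reduced X F) (ψ x) (ψ y)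
  ψ-adjacent = IsIsomorphism.adjacent F3 _ _

  module _ {K : Pred V 0ℓ} where

    -- The step from ψ s into a cell yields no edge of its own, hence the bound `pred n`, which
    -- makes positive lengths drop. K is kept general to serve both unrestricted walks (K empty) and
    -- walks inside n-cells.
    contract : ∀ {n p q s t} → Walk (induced X (∁ K)) n p q → p ≡ ψ s → q ≡ ψ t →
               ∃[ m ] (m ≤ pred n × Walk (induced X (∁ (K ∘ ψ))) m s t)
    -- Here p is inside a cell, and ψ s, the last visited vertex of F, is on the boundary of that
    -- cell.
    contractFromCell : ∀ {n p q s t} → Walk (induced X (∁ K)) n p q → p ∉ F →
                       ψ s ∈ θ X (component F p) → ψ s ∉ K → q ≡ ψ t →
                       ∃[ m ] (m ≤ n × Walk (induced X (∁ (K ∘ ψ))) m s t)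

    contract []                         refl eq with refl ← ψ-injective eq = 0 , z≤n , []
    contract ((s∉K , _ , ψs~r) ∷ walk) refl eq =
      contractFromCell walk r∉F (∈θ (component∈𝒞 r∉F) ε ψ∈F ψs~r) s∉K eq
      where r∉F = λ r∈F → F1 ψ∈F r∈F ψs~r

    contractFromCell [] p∉F _ _ refl = contradiction ψ∈F p∉F
    contractFromCell {p = p} {s = s} (_∷_ {y = r} (_ , r∉K , p~r) walk) p∉F s∈θ s∉K eq with em {F r}
    ... | no r∉F =
      let m , m≤n , walk′ = contractFromCell walk r∉F
            (θ-mono (𝒞-disjoint (component∈𝒞 p∉F) (component∈𝒞 r∉F) ((p∉F , r∉F , p~r) ◅ ε) ε) s∈θ) s∉K eq
      in m , m≤n⇒m≤1+n m≤n , walk′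
    ... | yes r∈F
      with u , _ , refl ← ψ-surjective r∈F
      with m , m≤n , walk′ ← contract walk refl eq
      with em {s ≡ u}
    -- The walk returns to the last visited vertex of F, so no edge is added.
    ...   | yes refl = m , ≤-trans m≤n (≤-trans pred[n]≤n (n≤1+n _)) , walk′
    ...   | no s≢u   = suc m , s≤s (≤-trans m≤n pred[n]≤n) , (s∉K , r∉K , s~u) ∷ walk′
      where
      s~u = from ψ-adjacent (ψ∈F , ψ∈F , s≢u ∘ ψ-injective , component F p , component∈𝒞 p∉F ,
                             s∈θ , ∈θ (component∈𝒞 p∉F) ε ψ∈F (~-sym p~r))

  toWalk : ∀ {S} {G : Graph {V} S 0ℓ} {x y} → Star (Graph._~_ G) x y → ∃[ n ] Walk G n x y
  toWalk ε          = 0 , []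
  toWalk (e ◅ path) = let n , walk = toWalk path in suc n , e ∷ walk

  fromWalk : ∀ {S} {G : Graph {V} S 0ℓ} {n x y} → Walk G n x y → Star (Graph._~_ G) x y
  fromWalk []         = ε
  fromWalk (e ∷ walk) = e ◅ fromWalk walk

-- Constants shared by all cells.

module HomogeneouslySelfSimilar
  (em : ExcludedMiddle 0ℓ) {V : Set} (X : FullGraph V) (F : Pred V 0ℓ) (ψ : V → V) (b θX : ℕ)
  (ambient : IsAmbient X) (homogeneous : IsHomogeneouslySelfSimilar X F ψ)
  (innerDegree : IsConstantInnerDegree X F b)
  {C₀ : Pred V 0ℓ} (C₀∈𝒞 : C₀ ∈ 𝒞 X F) (sizeθC₀ : HasSize (θ X C₀) θX) where

  open Graph X using (_~_; ~-sym)
  open Graph (reduced X F) using () renaming (_~_ to _~ᶠ_)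
  open IsAmbient ambient
  open IsHomogeneouslySelfSimilar homogeneous
  open IsSelfSimilar isSelfSimilar
  open Components em X
  open Contraction em X F ψ isSelfSimilar

  -- The number of neighbours in X_F that a boundary vertex receives from one cell. By `0<t` the
  -- truncated subtraction loses nothing.
  t : ℕ
  t = θX ∸ 1

  hat-isomorphism-onto : ∀ {D E α} → IsIsomorphism (hat X D) (hat X E) α →
                         Image α (closure X D) ≐ closure X E
  hat-isomorphism-onto iso =
    (λ { (_ , x∈ , refl) → into x∈ }) , surjective
    where open IsIsomorphism iso

  closure-size : ∃[ N ] (∀ {D} → D ∈ 𝒞 X F → HasSize (closure X D) N)
  closure-size = let N , size = H1-finite C₀∈𝒞 in N , λ D∈𝒞 →
    let α , iso , _ = H1-iso C₀∈𝒞 D∈𝒞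
    in HasSize-resp-≐ (hat-isomorphism-onto iso) (HasSize-image α (IsIsomorphism.injective iso) size)

  θ-size : ∀ {D} → D ∈ 𝒞 X F → HasSize (θ X D) θX
  θ-size D∈𝒞 =
    let α , iso , θ≐ = H1-iso C₀∈𝒞 D∈𝒞
    in HasSize-resp-≐ θ≐
         (HasSize-image α (λ x∈ y∈ → IsIsomorphism.injective iso (inj₂ x∈) (inj₂ y∈)) sizeθC₀)

  -- By (F1) boundary vertices are not adjacent to one another, so every neighbour of v in `hat X D`
  -- lies in D itself.
  inner-size : ∀ {D v} → D ∈ 𝒞 X F → v ∈ θ X D → HasSize (λ y → v ~ y × y ∈ D) b
  inner-size D∈𝒞 v∈θ =
    HasSize-resp-≐
      ( (λ { (_ , inj₁ y∈D , v~y) → v~y , y∈D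
           ; (_ , inj₂ y∈θ , v~y) → contradiction v~y (F1 (∈𝒞⇒θ⊆ D∈𝒞 v∈θ) (∈𝒞⇒θ⊆ D∈𝒞 y∈θ)) })
      , (λ (v~y , y∈D) → inj₂ v∈θ , inj₁ y∈D , v~y))
      (innerDegree D∈𝒞 v∈θ)

  θ-others : ∀ {D v} → D ∈ 𝒞 X F → v ∈ θ X D → HasSize (θ X D ∖ ｛ v ｝) t
  θ-others D∈𝒞 v∈θ with _ , refl , size ← HasSize-∖ v∈θ (θ-size D∈𝒞) = size

  shared-boundary : ∀ {D E u v} → D ∈ 𝒞 X F → E ∈ 𝒞 X F → u ≢ v →
                    u ∈ θ X D → v ∈ θ X D → u ∈ θ X E → v ∈ θ X E → D ≐ E
  shared-boundary D∈𝒞 E∈𝒞 u≢v u∈θD v∈θD u∈θE v∈θE =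
    stable λ D≢E → u≢v (F2 D∈𝒞 E∈𝒞 D≢E (inj₂ u∈θD , inj₂ u∈θE) (inj₂ v∈θD , inj₂ v∈θE))

  someEdge : ∃[ x ] ∃[ y ] x ~ y
  someEdge =
    -- `o` lies off F and `ψ o` in F, so a path joining them is not trivial.
    let o , o∉F , _ = C₀∈𝒞
    in firstEdge (connected {o} {ψ o} _ _) λ o≡ψo → o∉F (subst (_∈ F) (sym o≡ψo) ψ∈F)
    where
    firstEdge : ∀ {x y} → Star _~_ x y → x ≢ y → ∃[ x ] ∃[ y ] x ~ y
    firstEdge ε       x≢x = contradiction refl x≢x
    firstEdge (e ◅ _) _   = _ , _ , e

  -- An edge of X is carried by ψ to an edge of X_F, so some cell has two distinct boundary
  -- vertices.
  0<t : 0 < t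
  0<t with x , y , x~y ← someEdge
      with _ , _ , ψx≢ψy , D , D∈𝒞 , ψx∈θ , ψy∈θ ← to ψ-adjacent x~y
      = HasSize-positive (ψy∈θ , ψx≢ψy) (θ-others D∈𝒞 ψx∈θ)

  instance
    t-nonZero : NonZero t
    t-nonZero = >-nonZero 0<t

  0<θX : 0 < θX
  0<θX = ≤-trans 0<t (m∸n≤m θX 1)

  θ-inhabited : ∀ {D} → HasSize (θ X D) θX → ∃ (θ X D)
  θ-inhabited size = HasSize-inhabited 0<θX size

  instance
    θX-nonZero : NonZero θX
    θX-nonZero = >-nonZero 0<θX

    b-nonZero : NonZero b
    b-nonZero with v , v∈θ@(_ , y , y∈C , y~v) ← θ-inhabited sizeθC₀ =
      >-nonZero (HasSize-positive (~-sym y~v , y∈C) (inner-size C₀∈𝒞 v∈θ))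

  other-boundary : ∀ {D v} → D ∈ 𝒞 X F → v ∈ θ X D → ∃[ u ] (u ∈ θ X D × v ≢ u)
  other-boundary D∈𝒞 v∈θ = HasSize-inhabited 0<t (θ-others D∈𝒞 v∈θ)

  -- Double counting at a vertex of F.

  -- For each cell at v, S contains the cell and its boundary vertices other than v, or misses all
  -- of these. The count then restricts to S, which is everything for degrees and an n-cell for
  -- inner degrees.
  Saturated : Pred V 0ℓ → V → Set₁
  Saturated S v = ∀ {D} → D ∈ 𝒞 X F → v ∈ θ X D → ∀ {y u} → y ∈ D → u ∈ θ X D → v ≢ u → y ∈ S ⇔ u ∈ S

  -- Count the pairs (y , u) of an X-neighbour and an X_F-neighbour of v
  -- belonging to the same cell.  By (F2) the cell is determined by u.
  neighbour-balance : ∀ {S v m n} → v ∈ F → Saturated S v →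
                      HasSize (λ y → v ~ y × y ∈ S) m → HasSize (λ u → v ~ᶠ u × u ∈ S) n →
                      m * t ≡ n * b
  neighbour-balance {S} {v} v∈F saturated sizeₘ sizeₙ =
    double-counting (λ y u → u ∈ θ X (component F y)) sizeₘ sizeₙ
      (λ (v~y , y∈S) →
        let D∈𝒞 , v∈θ = cellAt v~y
        in HasSize-resp-≐
             ( (λ (u∈θ , v≢u) →
                 ((v∈F , ∈𝒞⇒θ⊆ D∈𝒞 u∈θ , v≢u , _ , D∈𝒞 , v∈θ , u∈θ) , to (saturated D∈𝒞 v∈θ ε u∈θ v≢u) y∈S) , u∈θ)
             , (λ (((_ , _ , v≢u , _) , _) , u∈θ) → u∈θ , v≢u))
             (θ-others D∈𝒞 v∈θ))
      (λ ((_ , _ , v≢u , D , D∈𝒞 , v∈θ , u∈θ) , u∈S) → HasSize-resp-≐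
        ( (λ (v~y , y∈D) →
             (v~y , from (saturated D∈𝒞 v∈θ y∈D u∈θ v≢u) u∈S) ,
             θ-mono (𝒞-disjoint D∈𝒞 (proj₁ (cellAt v~y)) y∈D ε) u∈θ)
        , (λ ((v~y , _) , u∈θ′) →
             let E∈𝒞 , v∈θ′ = cellAt v~y
             in v~y , proj₂ (shared-boundary D∈𝒞 E∈𝒞 v≢u v∈θ u∈θ v∈θ′ u∈θ′) ε))
        (inner-size D∈𝒞 v∈θ))
    where
    cellAt : ∀ {y} → v ~ y → component F y ∈ 𝒞 X F × v ∈ θ X (component F y)
    cellAt v~y = let D∈𝒞 = component∈𝒞 (λ y∈F → F1 v∈F y∈F v~y) in D∈𝒞 , ∈θ D∈𝒞 ε v∈F v~y

  reduced-neighbours : ∀ {S : Pred V 0ℓ} {w n} → HasSize (λ x → w ~ x × ψ x ∈ S) n →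
                       HasSize (λ u → ψ w ~ᶠ u × u ∈ S) n
  reduced-neighbours size =
    HasSize-resp-≐
      ( (λ { (x , (w~x , ψx∈S) , refl) → to ψ-adjacent w~x , ψx∈S })
      , (λ { (ψw~u@(_ , u∈F , _) , u∈S) → case ψ-surjective u∈F of λ
             { (x , _ , refl) → x , (from ψ-adjacent ψw~u , u∈S) , refl } }))
      (HasSize-image ψ (λ _ _ → ψ-injective) size)

  neighbour-balance-ψ : ∀ {S : Pred V 0ℓ} {w n} → Saturated S (ψ w) → HasSize (λ x → w ~ x × ψ x ∈ S) n →
                        ∃[ m ] (HasSize (λ y → ψ w ~ y × y ∈ S) m × m * t ≡ n * b)
  neighbour-balance-ψ {S} saturated size =
    let m , sizeₘ = Finite-∩ em S (locallyFinite _)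
    in m , sizeₘ , neighbour-balance ψ∈F saturated sizeₘ (reduced-neighbours size)

  deg : V → ℕ
  deg x = proj₁ (locallyFinite {x} _)

  hasDegree : ∀ {x} → HasDegree X x (deg x)
  hasDegree = proj₂ (locallyFinite _)

  degree-balance : ∀ w → deg (ψ w) * t ≡ deg w * b
  degree-balance w
    with m , size , eq ← neighbour-balance-ψ {S = U} {w = w} (λ _ _ _ _ _ → mk⇔ _ _)
                           (HasSize-resp-≐ ((_, _) , proj₁) hasDegree)
    with refl ← HasSize-unique hasDegree (HasSize-resp-≐ (proj₁ , (_, _)) size)
    = eq

  reducedDegree : ∀ {w} → HasDegree (reduced X F) (ψ w) (deg w)
  reducedDegree =
    HasSize-resp-≐ (proj₁ , (_, _)) (reduced-neighbours {S = U} (HasSize-resp-≐ ((_, _) , proj₁) hasDegree))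

  someDegree : ∃[ w ] 0 < deg w
  someDegree = let x , y , x~y = someEdge in x , HasSize-positive x~y hasDegree

  -- Degrees in X and X_F, bounded geometry.

  bounded⇒b≡t : BoundedGeometry X → b ≡ t
  bounded⇒b≡t (M , bounded) with <-cmp b t
  ... | tri≈ _ b≡t _ = b≡t
  ... | tri< b<t _ _ = let w , 0<deg = someDegree in ⊥-elim (descent (deg w) w 0<deg ≤-refl)
    where
    -- `n` bounds the degree and is used up by the strict decrease, while b > 0 keeps the degree
    -- positive.
    descent : ∀ n w → 0 < deg w → ¬ deg w ≤ n
    descent zero    w 0<deg deg≤n = n≮0 (≤-trans 0<deg deg≤n)
    descent (suc n) w 0<deg deg≤n =
      descent n (ψ w)
        (*-cancelʳ-< _ 0 _ (begin-strict
          0              <⟨ *-mono-≤ 0<deg 0<b ⟩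
          deg w * b      ≡⟨ degree-balance w ⟨
          deg (ψ w) * t  ∎))
        (s≤s⁻¹ (≤-trans (*-cancelʳ-< _ _ _ (begin-strict
          deg (ψ w) * t  ≡⟨ degree-balance w ⟩
          deg w * b      <⟨ *-monoʳ-< (deg w) {{>-nonZero 0<deg}} b<t ⟩
          deg w * t      ∎)) deg≤n))
      where
      open ≤-Reasoning
      0<b = >-nonZero⁻¹ b
  ... | tri> _ _ t<b = let w , _ , M<deg = ascent (suc M)
                           n , size , n≤M = bounded {w} _
                       in ⊥-elim (<⇒≱ M<deg (subst (_≤ M) (HasSize-unique size hasDegree) n≤M))
    where
    ascent : ∀ n → ∃[ w ] (0 < deg w × n ≤ deg w)
    ascent zero    = let w , 0<deg = someDegree in w , 0<deg , z≤n
    ascent (suc n) with w , 0<deg , n≤deg ← ascent n =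
      ψ w , ≤-trans 0<deg (<⇒≤ increase) , ≤-<-trans n≤deg increase
      where
      open ≤-Reasoning
      increase : deg w < deg (ψ w)
      increase = *-cancelʳ-< _ _ _ (begin-strict
        deg w * t      <⟨ *-monoʳ-< (deg w) {{>-nonZero 0<deg}} t<b ⟩
        deg w * b      ≡⟨ degree-balance w ⟨
        deg (ψ w) * t  ∎)

  -- A single vertex suffices: ψ w has degree `deg w` in X_F, so equal degrees allow `deg w` to be
  -- cancelled from the balance.
  degrees-preserved⇒b≡t : DegreesPreserved X F → b ≡ t
  degrees-preserved⇒b≡t preserved
    with w , 0<deg ← someDegree
    with n , size , sizeᶠ ← preserved {ψ w} ψ∈F
    = sym (*-cancelˡ-≡ t b (deg w) {{>-nonZero 0<deg}}
        (trans (cong (_* t) (trans (HasSize-unique reducedDegree sizeᶠ) (HasSize-unique size hasDegree)))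
               (degree-balance w)))

  deg-ψ : b ≡ t → ∀ w → deg (ψ w) ≡ deg w
  deg-ψ b≡t w = *-cancelʳ-≡ _ _ t (trans (degree-balance w) (cong (deg w *_) b≡t))

  b≡t⇒degrees-preserved : b ≡ t → DegreesPreserved X F
  b≡t⇒degrees-preserved b≡t v∈F with w , _ , refl ← ψ-surjective v∈F =
    deg w , subst (HasDegree X (ψ w)) (deg-ψ b≡t w) hasDegree , reducedDegree

  -- All neighbours of x lie in the closure of its cell, and by (H1) the closures of all cells have
  -- one finite size.
  degree-off-F : ∃[ N ] (∀ {x} → x ∉ F → deg x ≤ N)
  degree-off-F = let N , sizeN = closure-size in N , λ x∉F →
    let D∈𝒞 = component∈𝒞 x∉F
    in HasSize-mono (neighbour∈closure D∈𝒞) hasDegree (sizeN D∈𝒞)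
    where
    neighbour∈closure : ∀ {x y} → component F x ∈ 𝒞 X F → x ~ y → y ∈ closure X (component F x)
    neighbour∈closure {y = y} D∈𝒞 x~y with em {F y}
    ... | yes y∈F = inj₂ (∈θ D∈𝒞 ε y∈F (~-sym x~y))
    ... | no y∉F  = inj₁ (∈𝒞⇒extend D∈𝒞 ε y∉F x~y)

  -- A vertex whose degree exceeds the bound off F lies in ψⁿ(V) for all n;
  -- two such vertices would be brought ever closer together by ψ⁻¹.
  b≡t⇒bounded : b ≡ t → BoundedGeometry X
  b≡t⇒bounded b≡t with N , deg≤N ← degree-off-F = bound
    where
    high⇒F : ∀ {x} → N < deg x → x ∈ F
    high⇒F N<deg = stable λ x∉F → <⇒≱ N<deg (deg≤N x∉F)

    -- `k` is the recursion measure, as `contract` only bounds the new length. Since `∅ ∘ ψ` is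
    -- again `∅`, contraction can be iterated.
    high-unique : ∀ k {n x y} → n ≤ k → Walk (induced X (∁ ∅)) n x y → N < deg x → N < deg y → x ≡ y
    high-unique k       {zero}  _       [] _ _ = refl
    high-unique (suc k) {suc n} (s≤s n≤k) walk highˣ highʸ
      with s , _ , refl ← ψ-surjective (high⇒F highˣ)
      with u , _ , refl ← ψ-surjective (high⇒F highʸ)
      with m , m≤n , walk′ ← contract walk refl refl
      = cong ψ (high-unique k (≤-trans m≤n n≤k) walk′
                 (subst (N <_) (deg-ψ b≡t s) highˣ) (subst (N <_) (deg-ψ b≡t u) highʸ))

    bound : BoundedGeometry X
    bound with em {∃[ s ] N < deg s}
    ... | no none       = N , λ {x} _ → deg x , hasDegree , ≮⇒≥ (λ high → none (x , high))
    -- No other vertex has degree above N, so the degree of s bounds them all.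
    ... | yes (s , high) = deg s , λ {x} _ → deg x , hasDegree , bound-at x
      where
      bound-at : ∀ x → deg x ≤ deg s
      bound-at x with em {N < deg x}
      ... | no ¬highˣ = ≤-trans (≮⇒≥ ¬highˣ) (<⇒≤ high)
      ... | yes highˣ =
        let n , walk = toWalk (Star.map (λ e → (λ ()) , (λ ()) , e) (connected {x} {s} _ _))
        in ≤-reflexive (cong deg (high-unique n ≤-refl walk highˣ high))

  -- Cells of higher order and their preimages under ψ.

  power-injective : ∀ n {x} → ψ x ∈ power ψ (suc n) → x ∈ power ψ n
  power-injective n (_ , y∈ , ψy≡ψx) = subst (_∈ power ψ n) (ψ-injective ψy≡ψx) y∈

  power⊆F : ∀ n → power ψ (suc n) ⊆ F
  power⊆F n (_ , _ , refl) = ψ∈F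

  F≐power1 : F ≐ power ψ 1
  F≐power1 = ψ-surjective , power⊆F 0

  1-cell : ∀ {D} → D ∈ 𝒞 X (power ψ 1) → D ∈ 𝒞 X F
  1-cell = 𝒞-resp-≐ (swap F≐power1)

  -- Vertices of F adjacent in X_F are images of adjacent vertices, so by
  -- (F1) they do not both lie in ψ²(V).
  boundary-avoids : ∀ n {D u v} → D ∈ 𝒞 X F → u ∈ θ X D → v ∈ θ X D → v ≢ u →
                    v ∈ power ψ (2 + n) → u ∉ power ψ (2 + n)
  boundary-avoids n D∈𝒞 u∈θ v∈θ v≢u (x , x∈ , refl) (y , y∈ , refl) =
    F1 (power⊆F n x∈) (power⊆F n y∈)
       (from ψ-adjacent (ψ∈F , ψ∈F , v≢u , _ , D∈𝒞 , v∈θ , u∈θ))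

  -- By `boundary-avoids`, u is outside ψ²⁺ⁿ(V), and so is E. As u is adjacent to the connected set
  -- E, both belong to D or neither does.
  cell-saturated : ∀ n {D v} → D ∈ 𝒞 X (power ψ (2 + n)) → v ∈ power ψ (2 + n) → Saturated D v
  cell-saturated n {D} D∈𝒞 v∈K {E} E∈𝒞 v∈θE {y} {u} y∈E u∈θE@(_ , z , z∈E , z~u) v≢u =
    mk⇔ (λ y∈D → ∈𝒞⇒extend D∈𝒞 (E⊆D y∈E y∈D z∈E) u∉K z~u)
        (λ u∈D → E⊆D z∈E (∈𝒞⇒extend D∈𝒞 u∈D (∈𝒞⇒avoids E∈𝒞 z∈E ∘ power⊆F (suc n)) (~-sym z~u)) y∈E)
    where
    E⊆D : ∀ {x} → x ∈ E → x ∈ D → E ⊆ D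
    E⊆D = 𝒞-⊆ (power⊆F (suc n)) E∈𝒞 D∈𝒞
    u∉K = boundary-avoids n E∈𝒞 u∈θE v∈θE v≢u v∈K

  -- If o is off F, at most one of two boundary vertices of its cell lies in ψ²⁺ⁿ(V); the other is
  -- in F and joins D.
  cell-meets-F : ∀ n {D} → D ∈ 𝒞 X (power ψ (2 + n)) → ∃[ x ] ψ x ∈ D
  cell-meets-F n {D} D∈𝒞@(o , o∉K , _ , ⊆D) with em {F o}
  ... | yes o∈F with x , _ , refl ← ψ-surjective o∈F = x , ⊆D ε
  ... | no o∉F
    with E∈𝒞 ← component∈𝒞 o∉F
    with v , v∈θ ← θ-inhabited (θ-size E∈𝒞)
    with u , u∈θ , v≢u ← other-boundary E∈𝒞 v∈θ
    = [ inD v∈θ , inD u∈θ ]′ (avoids em)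
    where
    inD : ∀ {w} → w ∈ θ X (component F o) → w ∉ power ψ (2 + n) → ∃[ x ] ψ x ∈ D
    inD w∈θ@(_ , z , z∈E , z~w) w∉K with x , _ , refl ← ψ-surjective (∈𝒞⇒θ⊆ (component∈𝒞 o∉F) w∈θ) =
      x , ∈𝒞⇒extend D∈𝒞 (⊆D (component-antitone (power⊆F (suc n)) z∈E)) w∉K z~w
    avoids : Dec (v ∈ power ψ (2 + n)) → v ∉ power ψ (2 + n) ⊎ u ∉ power ψ (2 + n)
    avoids (no v∉K)  = inj₁ v∉K
    avoids (yes v∈K) = inj₂ (boundary-avoids n E∈𝒞 u∈θ v∈θ v≢u v∈K)

  -- A walk in D between points of F contracts to one avoiding ψ¹⁺ⁿ(V); conversely an edge avoiding
  -- that set lifts to a passage through one cell inside D.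
  cell-preimage : ∀ n {D} → D ∈ 𝒞 X (power ψ (2 + n)) → D ∘ ψ ∈ 𝒞 X (power ψ (1 + n))
  cell-preimage n {D} D∈𝒞 with x , ψx∈D ← cell-meets-F n D∈𝒞 =
    x , avoids ψx∈D , contracted , extended ψx∈D
    where
    avoids : ∀ {y} → ψ y ∈ D → y ∉ power ψ (1 + n)
    avoids ψy∈D y∈ = ∈𝒞⇒avoids D∈𝒞 ψy∈D (_ , y∈ , refl)

    contracted : ∀ {y} → ψ y ∈ D → component (power ψ (1 + n)) x y
    contracted ψy∈D =
      let _ , walk = toWalk (∈𝒞⇒⊆component D∈𝒞 ψx∈D ψy∈D)
          _ , _ , walk′ = contract walk refl refl
      in Star.map (λ (y∉ , z∉ , y~z) → (λ y∈ → y∉ (_ , y∈ , refl)) , (λ z∈ → z∉ (_ , z∈ , refl)) , y~z)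
                  (fromWalk walk′)

    extended : ∀ {y z} → ψ y ∈ D → component (power ψ (1 + n)) y z → ψ z ∈ D
    extended ψy∈D ε = ψy∈D
    extended ψy∈D ((y∉ , z∉ , y~z) ◅ path)
      -- ψ y and ψ z are boundary vertices of one cell E; E meets D next to ψ y, hence lies in D and
      -- leads to ψ z.
      with _ , _ , _ , E , E∈𝒞 , (_ , p , p∈E , p~ψy) , (_ , q , q∈E , q~ψz) ← to ψ-adjacent y~z
      = extended (∈𝒞⇒extend D∈𝒞 (𝒞-⊆ (power⊆F (suc n)) E∈𝒞 D∈𝒞 p∈E p∈D q∈E) (z∉ ∘ power-injective (suc n)) q~ψz) path
      where p∈D = ∈𝒞⇒extend D∈𝒞 ψy∈D (∈𝒞⇒avoids E∈𝒞 p∈E ∘ power⊆F (suc n)) (~-sym p~ψy)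

  boundary-cell : ∀ n {D v} → D ∈ 𝒞 X (power ψ (suc n)) → v ∈ θ X D →
                  ∃[ E ] (E ∈ 𝒞 X F × E ⊆ D × v ∈ θ X E)
  boundary-cell n {D} {v} D∈𝒞 v∈θ@(_ , y , y∈D , y~v) =
    component F y , E∈𝒞 , 𝒞-⊆ (power⊆F n) E∈𝒞 D∈𝒞 ε y∈D , ∈θ E∈𝒞 ε v∈F (~-sym y~v)
    where
    v∈F = power⊆F n (∈𝒞⇒θ⊆ D∈𝒞 v∈θ)
    E∈𝒞 = component∈𝒞 λ y∈F → F1 y∈F v∈F y~v

  -- At a vertex of θD, saturation transfers membership in D across a cell, between its X-neighbours
  -- there and its X_F-neighbours.
  cell-θ-preimage : ∀ n {D} → D ∈ 𝒞 X (power ψ (2 + n)) → Image ψ (θ X (D ∘ ψ)) ≐ θ X D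
  cell-θ-preimage n {D} D∈𝒞 = ψθ⊆θ , θ⊆ψθ
    where
    ψθ⊆θ : Image ψ (θ X (D ∘ ψ)) ⊆ θ X D
    ψθ⊆θ (w , w∈θ@(ψw∉D , x , ψx∈D , x~w) , refl)
      with _ , _ , ψx≢ψw , E , E∈𝒞 , ψx∈θ , ψw∈θ@(_ , y , y∈E , y~ψw) ← to ψ-adjacent x~w
      = ψw∉D , y , from (cell-saturated n D∈𝒞 ψw∈K E∈𝒞 ψw∈θ y∈E ψx∈θ (ψx≢ψw ∘ sym)) ψx∈D , y~ψw
      where ψw∈K = w , ∈𝒞⇒θ⊆ (cell-preimage n D∈𝒞) w∈θ , refl

    θ⊆ψθ : θ X D ⊆ Image ψ (θ X (D ∘ ψ))
    θ⊆ψθ v∈θ@(v∉D , y , y∈D , y~v)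
      with v∈K@(w , w∈ , refl) ← ∈𝒞⇒θ⊆ D∈𝒞 v∈θ
      with E , E∈𝒞 , E⊆D , v∈θE@(_ , z , z∈E , _) ← boundary-cell (suc n) D∈𝒞 v∈θ
      with u , u∈θE , v≢u ← other-boundary E∈𝒞 v∈θE
      with x , _ , refl ← ψ-surjective (∈𝒞⇒θ⊆ E∈𝒞 u∈θE)
      = w , (v∉D , x , to (cell-saturated n D∈𝒞 v∈K E∈𝒞 v∈θE z∈E u∈θE v≢u) (E⊆D z∈E)
                 , from ψ-adjacent (ψ∈F , ψ∈F , v≢u ∘ sym , _ , E∈𝒞 , u∈θE , v∈θE)) , refl

  n-cell-θ-size : ∀ n {D} → D ∈ 𝒞 X (power ψ (suc n)) → HasSize (θ X D) θX
  n-cell-θ-size zero    D∈𝒞 = θ-size (1-cell D∈𝒞)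
  n-cell-θ-size (suc n) D∈𝒞 =
    HasSize-resp-≐ (cell-θ-preimage n D∈𝒞)
      (HasSize-image ψ (λ _ _ → ψ-injective) (n-cell-θ-size n (cell-preimage n D∈𝒞)))

  inner-balance : ∀ n {D d} → D ∈ 𝒞 X (power ψ (2 + n)) →
                  (∀ {w} → w ∈ θ X (D ∘ ψ) → HasSize (λ x → w ~ x × x ∈ D ∘ ψ) d) →
                  ∀ {v} → v ∈ θ X D → ∃[ e ] (HasSize (λ y → v ~ y × y ∈ D) e × e * t ≡ d * b)
  inner-balance n D∈𝒞 size v∈θ with w , w∈θ , refl ← proj₂ (cell-θ-preimage n D∈𝒞) v∈θ =
    neighbour-balance-ψ (cell-saturated n D∈𝒞 (∈𝒞⇒θ⊆ D∈𝒞 v∈θ)) (size w∈θ)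

  n-cell-inner-size : b ≡ t → ∀ n {D v} → D ∈ 𝒞 X (power ψ (suc n)) → v ∈ θ X D →
                      HasSize (λ y → v ~ y × y ∈ D) b
  n-cell-inner-size b≡t zero    D∈𝒞 v∈θ = inner-size (1-cell D∈𝒞) v∈θ
  n-cell-inner-size b≡t (suc n) D∈𝒞 v∈θ
    with e , size , e*t≡b*b ← inner-balance n D∈𝒞 (n-cell-inner-size b≡t n (cell-preimage n D∈𝒞)) v∈θ
    with refl ← *-cancelʳ-≡ e b t (trans e*t≡b*b (cong (b *_) b≡t))
    = size

  -- Edge boundaries and boundary cells.

  δ₀-size : HasSize (δ X C₀) (θX * b)
  δ₀-size = δ-size sizeθC₀ (inner-size C₀∈𝒞)

  b≡t⇒constant-δ : b ≡ t → ConstantEdgeBoundary X ψ (θX * b)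
  b≡t⇒constant-δ b≡t (suc n) _ D∈𝒞 = δ-size (n-cell-θ-size n D∈𝒞) (n-cell-inner-size b≡t n D∈𝒞)

  2-cell : ∃[ D ] (D ∈ 𝒞 X (power ψ 2))
  2-cell = let o , o∉F , _ = C₀∈𝒞 in _ , component∈𝒞 (o∉F ∘ power⊆F 1)

  -- For 1-cells the inner degree is b by hypothesis, so this holds before b = t is known.
  2-cell-inner : ∀ {D v} → D ∈ 𝒞 X (power ψ 2) → v ∈ θ X D →
                 ∃[ e ] (HasSize (λ y → v ~ y × y ∈ D) e × e * t ≡ b * b)
  2-cell-inner D∈𝒞 = inner-balance 0 D∈𝒞 (inner-size (1-cell (cell-preimage 0 D∈𝒞)))

  2-cell-inner-b⇒b≡t : ∀ {e} → e * t ≡ b * b → e ≡ b → b ≡ t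
  2-cell-inner-b⇒b≡t e*t≡b*b refl = sym (*-cancelˡ-≡ t b b e*t≡b*b)

  -- The equation e t = b² forces one inner degree e at all boundary vertices of a 2-cell. Its edge
  -- boundary thus has θ_X e edges, and comparison with θ_X b gives e = b.
  constant-δ⇒b≡t : ConstantEdgeBoundary X ψ (θX * b) → b ≡ t
  constant-δ⇒b≡t constant
    with D , D∈𝒞 ← 2-cell
    with v , v∈θ ← θ-inhabited (n-cell-θ-size 1 D∈𝒞)
    with e , _ , e*t≡b*b ← 2-cell-inner D∈𝒞 v∈θ
    = 2-cell-inner-b⇒b≡t e*t≡b*b
        (*-cancelˡ-≡ e b θX (HasSize-unique (δ-size (n-cell-θ-size 1 D∈𝒞) sameInner) (constant 2 z<s D∈𝒞)))
    where
    sameInner : ∀ {w} → w ∈ θ X D → HasSize (λ y → w ~ y × y ∈ D) e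
    sameInner w∈θ
      with e′ , size , e′*t≡b*b ← 2-cell-inner D∈𝒞 w∈θ
      with refl ← *-cancelʳ-≡ e′ e t (trans e′*t≡b*b (sym e*t≡b*b))
      = size

  -- Every neighbour of v in a 2-cell D belongs to a cell inside D with v on its boundary. If E is
  -- the only such cell, v has just b neighbours in D.
  unique-boundary-cell⇒b≡t : UniqueBoundaryCell X F ψ → b ≡ t
  unique-boundary-cell⇒b≡t unique
    with D , D∈𝒞 ← 2-cell
    with v , v∈θ ← θ-inhabited (n-cell-θ-size 1 D∈𝒞)
    with e , size , e*t≡b*b ← 2-cell-inner D∈𝒞 v∈θ
    with E , (E∈𝒞 , E⊆D , v∈θE) , E-unique ← unique 2 z<s D∈𝒞 v∈θ
    = 2-cell-inner-b⇒b≡t e*t≡b*b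
        (HasSize-unique size
          (HasSize-resp-≐
            ((λ (v~y , y∈E) → v~y , E⊆D y∈E) , (λ (v~y , y∈D) → v~y , inE v~y y∈D))
            (inner-size E∈𝒞 v∈θE)))
    where
    inE : ∀ {y} → v ~ y → y ∈ D → y ∈ E
    inE v~y y∈D =
      let v∈F = ∈𝒞⇒θ⊆ E∈𝒞 v∈θE
          y-cell = component∈𝒞 (λ y∈F → F1 v∈F y∈F v~y)
      in proj₂ (E-unique (y-cell , 𝒞-⊆ (power⊆F 1) y-cell D∈𝒞 ε y∈D , ∈θ y-cell ε v∈F v~y)) ε

  -- E already contains b neighbours of v, which are all that v has in D; a second cell would
  -- contain a further one.
  b≡t⇒unique-boundary-cell : b ≡ t → UniqueBoundaryCell X F ψ
  b≡t⇒unique-boundary-cell b≡t (suc n) _ {D} D∈𝒞 {v} v∈θ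
    with E , E∈𝒞 , E⊆D , v∈θE ← boundary-cell n D∈𝒞 v∈θ
    = E , (E∈𝒞 , E⊆D , v∈θE) , λ (G∈𝒞 , G⊆D , (_ , y , y∈G , y~v)) →
        stable λ E≢G → ⊆∧sameSize⇒⊇ (λ (v~y , y∈E) → v~y , E⊆D y∈E)
          (inner-size E∈𝒞 v∈θE) (n-cell-inner-size b≡t n D∈𝒞 v∈θ)
          (~-sym y~v , G⊆D y∈G)
          (λ (_ , y∈E) → E≢G (𝒞-disjoint E∈𝒞 G∈𝒞 y∈E y∈G))

theorem3 : ExcludedMiddle 0ℓ →
    ∀ {V : Set} (X : FullGraph V) (F : Pred V 0ℓ) (ψ : V → V) (b θX δX : ℕ) →
    IsAmbient X →
    IsHomogeneouslySelfSimilar X F ψ →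
    IsConstantInnerDegree X F b →
    ∀ (C : Pred V 0ℓ) → C ∈ 𝒞 X F → HasSize (θ X C) θX → HasSize (δ X C) δX →
    let i   = BoundedGeometry X
        ii  = b ≡ θX ∸ 1
        iii = LocallyFinite X × DegreesPreserved X F
        iv  = ConstantEdgeBoundary X ψ δX
        v   = UniqueBoundaryCell X F ψ
        vi  = δX ≡ θX * (θX ∸ 1)
    in (i ⇔ ii) × (i ⇔ iii) × (i ⇔ iv) × (i ⇔ v) × (i ⇔ vi)
theorem3 em X F ψ b θX δX ambient homogeneous innerDegree C C∈𝒞 sizeθ sizeδ
  -- Counting edges at the boundary vertices of C gives δ_X = θ_X b, so (vi) becomes (ii) after
  -- cancelling θ_X.
  with refl ← HasSize-unique sizeδ
         (HomogeneouslySelfSimilar.δ₀-size em X F ψ b θX ambient homogeneous innerDegree C∈𝒞 sizeθ)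
  = mk⇔ bounded⇒b≡t b≡t⇒bounded
  , mk⇔ (λ i → (λ {_} → locallyFinite) , λ {_} → b≡t⇒degrees-preserved (bounded⇒b≡t i))
        (b≡t⇒bounded ∘ degrees-preserved⇒b≡t ∘ proj₂)
  , mk⇔ (λ i → b≡t⇒constant-δ (bounded⇒b≡t i)) (λ iv → b≡t⇒bounded (constant-δ⇒b≡t iv))
  , mk⇔ (λ i → b≡t⇒unique-boundary-cell (bounded⇒b≡t i)) (λ v → b≡t⇒bounded (unique-boundary-cell⇒b≡t v))
  , mk⇔ (cong (θX *_) ∘ bounded⇒b≡t) (b≡t⇒bounded ∘ *-cancelˡ-≡ b (θX ∸ 1) θX)
  where
  open IsAmbient ambient using (locallyFinite)
  open HomogeneouslySelfSimilar em X F ψ b θX ambient homogeneous innerDegree C∈𝒞 sizeθ
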